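{- The algorithm $A$ described in the context, using the labels described there, is a $k$-gathering algorithm which works in time $O(D\Delta)$ with labels of size $O(\log\Delta)$.
   Context: Radio network: a simple undirected connected graph $G=(V,E)$ with diameter $D$ and maximum degree $\Delta$. Nodes communicate in synchronous rounds. In each round a node either transmits a message to all its neighbors or listens. A node $v$ hears a neighbor $w$ in a round iff $v$ listens and $w$ is the only neighbor of $v$ that transmits in this round; otherwise $v$ receives nothing and cannot tell whether any neighbor transmitted. Message size is unrestricted, so several source messages may be combined in one transmission. Non-spontaneous wake-up: only sources start at round $0$; every other node joins only after receiving a message. The current round number is added to every message, so awakened nodes know the global round number. Each node initially knows only its label (a binary string; labels need not be distinct) and, if it is a source, its message. The size of the labels is the maximum length of a label; time is the number of rounds. $k$-gathering: there are $k$ nodes $s_1,\dots,s_k$ (sources), each holding a message, and a node $r$ (the sink); all $k$ messages have to reach $r$. Objects used for the labels. Let $T$ be a fixed BFS tree of $G$ rooted at the sink $r$, and let $p(v)$ be the parent of $v$ in $T$. Let $T'$ be the smallest (with respect to inclusion) subtree of $T$ containing $r$ and all sources; every leaf of $T'$ is a source. Let $s:V\to\{0,\dots,\Delta-1\}$ be a function such that (a) $s(u)\ne s(w)$ for any two different children $u,w$ of the same node in $T$, and (b) there is no edge of $G$ between $u$ and $p(w)$ for any two nodes $u\ne w$ on the same level of $T$ with $s(u)=s(w)$. Let $c:V\to\{0,\dots,\Delta^2\}$ be a distance-two coloring of $G$ (different nodes at distance at most 2 have different colors). Labels: the label of $v$ consists of $s(v)$, $c(v)$, $c(p(v))$, $\Delta$,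 the number of children of $v$ in $T'$, and $l(v)\in\{0,1,2\}$, the level of $v$ in $T$ (its distance to the root) modulo 3. Algorithm $A$: the execution is split into phases, each consisting of three rounds $0,1,2$. A node $v$ that is supposed to send a message in a phase transmits in round $l(v)$ of that phase. At the beginning only the leaves of $T'$ are active; a leaf $v$ of $T'$ transmits its message in phase $s(v)$. Each non-leaf node $v$ of $T'$ (one whose stored number of children is larger than 0) sends nothing until it has received messages from all its children in $T'$. If it receives the last message from a child in phase $t$, then it transmits all received messages (together with its own source message, if it is a source) in the closest phase $t'>t$ with $t'\bmod\Delta=s(v)$, and it is inactive in all other phases. Each transmitting node $v$ appends $c(v)$ and $c(p(v))$ to its message. A node recognizes a received message as coming from a child by the appended parent color being equal to its own color, distinguishes different children by their appended colors, and knows that it has heard from all of its children by comparing with the number of children stored in its label. -}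

module Defs where

open import Level using (0ℓ)
open import Data.Bool.Base using (Bool; true; false; if_then_else_; _∧_)
open import Data.Fin.Base using (Fin; toℕ)
open import Data.Fin.Properties using (any?) renaming (_≟_ to _≟ᶠ_)
open import Data.Fin.Subset using (Subset; _∈_; _⊆_)
open import Data.Fin.Subset.Properties using (_∈?_)
open import Data.List.Base
  using (List; []; _∷_; _++_; [_]; length; filter; mapMaybe; concatMap; map;
         deduplicate; allFin; fromMaybe)
open import Data.List.Membership.Propositional using () renaming (_∈_ to _∈ˡ_)
open import Data.Maybe.Base as Maybe using (Maybe; just; nothing)
open import Data.Nat.Base
  using (ℕ; zero; suc; _+_; _*_; _^_; _≤_; _<_)
open import Data.Nat.Binary.Base as ℕᵇ using (ℕᵇ; 2[1+_]; 1+[2_])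
open import Data.Nat.DivMod using (_/_; _%_)
open import Data.Nat.Properties using (_≟_; _<?_; allUpTo?)
open import Data.Product.Base using (_×_; _,_; proj₁; proj₂; ∃; ∃-syntax; ∃₂; map₁)
open import Data.Sum.Base using (_⊎_)
open import Function.Base using (_∘_)
open import Relation.Binary.Core using (Rel)
open import Relation.Binary.Definitions using (Symmetric; Irreflexive; Decidable)
open import Relation.Binary.Construct.Closure.ReflexiveTransitive using (Star)
open import Relation.Binary.PropositionalEquality.Core using (_≡_; _≢_)
open import Relation.Nullary.Decidable.Core
  using (Dec; yes; no; does; ¬?; _×-dec_; _→-dec_)
open import Relation.Nullary.Negation.Core using (¬_)

record Network (n : ℕ) : Set₁ where
  field
    Adj       : Rel (Fin n) 0ℓ
    adj?      : Decidable Adj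
    symmetric : Symmetric Adj
    loopless  : Irreflexive _≡_ Adj
    connected : ∀ u v → Star Adj u v

module _ {n : ℕ} (G : Network n) where
  open Network G

  data Walk : ℕ → Fin n → Fin n → Set where
    []  : ∀ {v} → Walk 0 v v
    _∷_ : ∀ {d u v w} → Adj u v → Walk d v w → Walk (suc d) u w

  DistanceAtMost : ℕ → Fin n → Fin n → Set
  DistanceAtMost d u v = ∃[ e ] (e ≤ d × Walk e u v)

  Distance : ℕ → Fin n → Fin n → Set
  Distance d u v = Walk d u v × (∀ e → Walk e u v → d ≤ e)

  IsDiameter : ℕ → Set
  IsDiameter D = (∀ u v → DistanceAtMost D u v) × (∃₂ λ u v → Distance D u v)

  neighbours : Fin n → List (Fin n)
  neighbours v = filter (adj? v) (allFin n)

  degree : Fin n → ℕ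
  degree v = length (neighbours v)

  IsMaxDegree : ℕ → Set
  IsMaxDegree Δ = (∀ v → degree v ≤ Δ) × (∃[ v ] degree v ≡ Δ)

-- A transmission combines any number of source messages (of type M) with
-- control information chosen by the protocol.
record Message (Control M : Set) : Set where
  constructor message
  field
    control : Control
    content : List M

-- Received messages, latest first, each with the round number it carries.
History : Set → Set → Set
History Control M = List (ℕ × Message Control M)

-- What an awake node transmits (nothing: it listens), as a function of its
-- label, its source message if any, what it has received so far and the
-- current round.  Parametricity in M prevents forging source messages.
record Protocol : Set₁ where
  field
    Control  : Set
    transmit : {M : Set} → List Bool → Maybe M → History Control M → ℕ →
               Maybe (Message Control M)

awake : {A B : Set} → Maybe A → List B → Bool
awake nothing [] = false
awake _       _  = true

unique : {A : Set} → List A → Maybe A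
unique (x ∷ []) = just x
unique _        = nothing

module Execution {n : ℕ} (G : Network n) (P : Protocol)
                 (label : Fin n → List Bool)
                 {M : Set} (own : Fin n → Maybe M) where
  open Protocol P

  transmission : (Fin n → History Control M) → ℕ → Fin n →
                 Maybe (Message Control M)
  transmission h t v =
    if awake (own v) (h v) then transmit (label v) (own v) (h v) t else nothing

  reception : (Fin n → History Control M) → ℕ → Fin n →
              Maybe (Message Control M)
  reception h t v with transmission h t v
  ... | just _  = nothing
  ... | nothing = unique (mapMaybe (transmission h t) (neighbours G v))

  -- history t v is what v has received in rounds 0, …, t - 1.
  history : ℕ → Fin n → History Control M
  history zero    v = []
  history (suc t) v =
    fromMaybe (Maybe.map (t ,_) (reception (history t) t v)) ++ history t v

  known : ℕ → Fin n → List M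
  known t v =
    fromMaybe (own v) ++ concatMap (Message.content ∘ proj₂) (history t v)

sourceMessage : ∀ {n k} {M : Set} → (Fin k → Fin n) → (Fin k → M) →
                Fin n → Maybe M
sourceMessage source msg v with any? (λ i → source i ≟ᶠ v)
... | yes (i , _) = just (msg i)
... | no  _       = nothing

-- M is arbitrary; M = Fin k and msg = id give pairwise distinct messages.
Gathers : ∀ {n k} → Network n → Protocol → (Fin n → List Bool) →
          (Fin k → Fin n) → Fin n → ℕ → Set₁
Gathers {k = k} G P label source r t =
  ∀ (M : Set) (msg : Fin k → M) (i : Fin k) →
  msg i ∈ˡ Execution.known G P label (sourceMessage source msg) t r

-- The root, which has no parent, is given itself as parent by convention;
-- IsChild below excludes this pair.
record BFSTree {n : ℕ} (G : Network n) (r : Fin n) : Set where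
  open Network G
  field
    parent       : Fin n → Fin n
    parent-root  : parent r ≡ r
    parent-adj   : ∀ v → v ≢ r → Adj v (parent v)
    level        : Fin n → ℕ
    level-root   : level r ≡ 0
    level-parent : ∀ v → v ≢ r → level v ≡ suc (level (parent v))
    level-dist   : ∀ v → Distance G (level v) r v

module _ {n : ℕ} {G : Network n} {r : Fin n} (T : BFSTree G r) where
  open Network G
  open BFSTree T

  IsChild : Fin n → Fin n → Set
  IsChild u v = u ≢ r × parent u ≡ v

  isChild? : Decidable IsChild
  isChild? u v = ¬? (u ≟ᶠ r) ×-dec (parent u ≟ᶠ v)

  TreeEdge : Rel (Fin n) 0ℓ
  TreeEdge u v = IsChild u v ⊎ IsChild v u

  -- A subtree is given by its vertex set.
  IsSubtree : Subset n → Set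
  IsSubtree S = ∀ u v → u ∈ S → v ∈ S →
                Star (λ x y → TreeEdge x y × x ∈ S × y ∈ S) u v

  Spans : ∀ {k} → (Fin k → Fin n) → Subset n → Set
  Spans source S = IsSubtree S × r ∈ S × (∀ i → source i ∈ S)

  IsSmallestSubtree : ∀ {k} → (Fin k → Fin n) → Subset n → Set
  IsSmallestSubtree source T′ =
    Spans source T′ × (∀ S → Spans source S → T′ ⊆ S)

  childCount : Subset n → Fin n → ℕ
  childCount T′ v =
    length (filter (λ u → isChild? u v ×-dec (u ∈? T′)) (allFin n))

  IsSlotAssignment : ∀ {Δ} → (Fin n → Fin Δ) → Set
  IsSlotAssignment s =
    (∀ v u w → IsChild u v → IsChild w v → u ≢ w → s u ≢ s w) ×
    (∀ u w → u ≢ w → level u ≡ level w → s u ≡ s w → ¬ Adj u (parent w))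

IsDistanceTwoColouring : ∀ {n m} → Network n → (Fin n → Fin m) → Set
IsDistanceTwoColouring G c =
  ∀ u v → u ≢ v → DistanceAtMost G 2 u v → c u ≢ c v

record LabelData : Set where
  constructor labelData
  field
    slot          : ℕ
    colour        : ℕ
    parentColour  : ℕ
    maxDegree     : ℕ
    children      : ℕ
    level3        : ℕ

-- A number is written in bijective base 2, each digit being preceded by
-- true, and false marks the end; so numbers can be concatenated.
encodeᵇ : ℕᵇ → List Bool
encodeᵇ ℕᵇ.zero  = [ false ]
encodeᵇ 2[1+ x ] = true ∷ false ∷ encodeᵇ x
encodeᵇ 1+[2 x ] = true ∷ true ∷ encodeᵇ x

decodeᵇ : List Bool → ℕᵇ × List Bool
decodeᵇ (true ∷ false ∷ bs) = map₁ 2[1+_] (decodeᵇ bs)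
decodeᵇ (true ∷ true ∷ bs)  = map₁ 1+[2_] (decodeᵇ bs)
decodeᵇ (true ∷ [])         = ℕᵇ.zero , []
decodeᵇ (false ∷ bs)        = ℕᵇ.zero , bs
decodeᵇ []                  = ℕᵇ.zero , []

encodeℕ : ℕ → List Bool
encodeℕ = encodeᵇ ∘ ℕᵇ.fromℕ

decodeℕ : List Bool → ℕ × List Bool
decodeℕ = map₁ ℕᵇ.toℕ ∘ decodeᵇ

encode : LabelData → List Bool
encode (labelData s c cp Δ ch l) =
  encodeℕ s ++ encodeℕ c ++ encodeℕ cp ++ encodeℕ Δ ++ encodeℕ ch ++ encodeℕ l

decode : List Bool → LabelData
decode bs₀ =
  let s  , bs₁ = decodeℕ bs₀
      c  , bs₂ = decodeℕ bs₁
      cp , bs₃ = decodeℕ bs₂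
      Δ  , bs₄ = decodeℕ bs₃
      ch , bs₅ = decodeℕ bs₄
      l  , _   = decodeℕ bs₅
  in labelData s c cp Δ ch l

labels : ∀ {n m Δ} {G : Network n} {r : Fin n} (T : BFSTree G r) →
         Subset n → (Fin n → Fin Δ) → (Fin n → Fin m) → Fin n → List Bool
labels {Δ = Δ} T T′ s c v = encode (labelData
  (toℕ (s v)) (toℕ (c v)) (toℕ (c (parent v))) Δ (childCount T T′ v)
  (level v % 3))
  where open BFSTree T

-- The value at modulus 0 is never used: Δ ≥ 1 in every actual label.
_modulo_ : ℕ → ℕ → ℕ
m modulo zero    = m
m modulo (suc n) = m % suc n

-- q is the first phase after t that is congruent to s modulo Δ.
ClosestPhase : (Δ s t q : ℕ) → Set
ClosestPhase Δ s t q =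
  (t < q × q modulo Δ ≡ s) × (∀ {x} → x < q → t < x → x modulo Δ ≢ s)

closestPhase? : ∀ Δ s t q → Dec (ClosestPhase Δ s t q)
closestPhase? Δ s t q =
  ((t <? q) ×-dec (q modulo Δ ≟ s)) ×-dec
  allUpTo? (λ x → (t <? x) →-dec ¬? (x modulo Δ ≟ s)) q

record Colours : Set where
  constructor colours
  field
    sender       : ℕ
    senderParent : ℕ

module _ {M : Set} (L : LabelData) (own : Maybe M) (h : History Colours M) where
  open LabelData L

  childReceptions : History Colours M
  childReceptions =
    filter (λ e → Colours.senderParent (Message.control (proj₂ e)) ≟ colour) h

  heardChildren : ℕ
  heardChildren = length (deduplicate _≟_
    (map (Colours.sender ∘ Message.control ∘ proj₂) childReceptions))

  -- A node with no children in T′ is a leaf of T′ exactly if it is a source.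
  leafContent : ℕ → Maybe (List M)
  leafContent phase =
    if does (phase ≟ slot) then Maybe.map [_] own else nothing

  innerContent : ℕ → Maybe (List M)
  innerContent phase with childReceptions
  ... | []          = nothing
  ... | (t , _) ∷ _ =
    if does (heardChildren ≟ children) ∧
       does (closestPhase? maxDegree slot (t / 3) phase)
    then just (fromMaybe own ++ concatMap (Message.content ∘ proj₂) h)
    else nothing

  phaseContent : ℕ → Maybe (List M)
  phaseContent phase =
    if does (children ≟ 0) then leafContent phase else innerContent phase

  transmitA : ℕ → Maybe (Message Colours M)
  transmitA round =
    if does (round % 3 ≟ level3)
    then Maybe.map (message (colours colour parentColour)) (phaseContent (round / 3))
    else nothing

algorithmA : Protocol
algorithmA = record
  { Control  = Colours
  ; transmit = transmitA ∘ decode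
  }

module Submission where

-- The constants are 3 and 54.
--
-- No collision between a child and its parent.  A node v transmits only in phases that
-- are congruent to s(v) modulo Δ and, within a phase, in the round given by its level
-- modulo 3.  When a child u of v transmits, the parent v is silent because its level has
-- another residue, and any other transmitting neighbour w of v has the same residue,
-- hence the same level as u, and the same slot; the slot assignment
-- excludes such an edge between w and v.  So v hears every transmission of every child
-- (parent-hears).  By the distance-two colouring,
-- the colours appended to a message tell v exactly which receptions come from children,
-- and from which child (childRx-sound, kids-distinct).
--
-- Timing.  By induction from the deepest level upwards (transmits), every node v of T′
-- other than the root transmits in exactly one round, within the first κ * Δ phases,
-- where κ is D minus the level of v, plus one, and the message contains all source
-- messages of the subtree of v.  A leaf of T′ is a source by minimality of T′
-- (leaf-is-source) and transmits in phase s(v) < Δ.  An inner node waits for its last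
-- child, whose phase is below (κ - 1) * Δ by induction; the phase s(v) + (κ - 1) * Δ lies
-- after it and is congruent to s(v), so the closest such phase is below κ * Δ
-- (inner-transmits).  That children transmit only once matters here: a second reception
-- from a child would move the waiting node to a later phase or make it transmit twice.
-- The children of the root have κ = D, so the root knows everything after D * Δ phases,
-- that is, 3 * D * Δ rounds (root-gathers).
--
-- Size.  Each of the six numbers of a label is at most Δ squared or at most 2, and the
-- encoding spends about two bits per binary digit (length-labels).

open import Defs
open import Data.Bool.Base using (Bool; if_then_else_)
open import Data.Bool.Properties using (if-eta)
open import Data.Fin.Base using (Fin; toℕ; zero; suc)
open import Data.Fin.Properties
  using (any?; injective⇒≤; toℕ<n; toℕ-injective) renaming (_≟_ to _≟ᶠ_)
open import Data.Fin.Subset using (Subset; _∈_; _∩_; ∁; ⁅_⁆)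
open import Data.Fin.Subset.Properties
  using (_∈?_; x∈⁅x⁆; x≢y⇒x∉⁅y⁆; x∈p∩q⁺; x∈p∩q⁻; x∈∁p⇒x∉p; x∉p⇒x∈∁p)
open import Data.List.Base
  using (List; []; _∷_; _++_; [_]; length; lookup; map; mapMaybe; filter; allFin;
         fromMaybe; concatMap; deduplicate)
open import Data.List.Membership.Propositional using () renaming (_∈_ to _∈ˡ_)
open import Data.List.Membership.Propositional.Properties
  using (∈-length; ∈-lookup; ∈-allFin; ∈-filter⁺; ∈-filter⁻; ∈-map⁺; ∈-map⁻; ∈-++⁺ˡ; ∈-++⁺ʳ;
         ∈-deduplicate⁺; ∈-deduplicate⁻; ∈-concatMap⁺)
open import Data.List.Properties using (++-identityʳ; length-++)
open import Data.List.Relation.Unary.All using ([]; _∷_; tabulate)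
  renaming (lookup to lookupAll)
open import Data.List.Relation.Unary.AllPairs using (AllPairs; []; _∷_)
import Data.List.Relation.Unary.AllPairs.Properties as AllPairs
open import Data.List.Relation.Unary.Any using (here; there; index)
  renaming (map to mapAny)
open import Data.List.Relation.Unary.Any.Properties using (lookup-index)
open import Data.List.Relation.Unary.Unique.Propositional using (Unique)
open import Data.List.Relation.Unary.Unique.Propositional.Properties
  using (allFin⁺; filter⁺)
open import Data.List.Relation.Unary.Unique.DecPropositional.Properties
  using (deduplicate-!)
open import Data.Maybe.Base as Maybe using (Maybe; just; nothing)
open import Data.Nat.Base
open import Data.Nat.Binary.Base as ℕᵇ using (ℕᵇ; 2[1+_]; 1+[2_])
open import Data.Nat.Binary.Properties using (toℕ-fromℕ)
open import Data.Nat.DivMod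
open import Data.Nat.Induction using (<-rec)
open import Data.Nat.Logarithm using (⌊log₂_⌋; ⌊log₂⌋-mono-≤; ⌊log₂[2^n]⌋≡n)
open import Data.Nat.Properties
open import Data.Nat.Tactic.RingSolver using (solve-∀)
open import Data.Product.Base
  using (_×_; _,_; proj₁; proj₂; ∃; ∃₂; ∃-syntax; map₁; map₂)
open import Data.Sum.Base using (_⊎_; inj₁; inj₂)
open import Function.Base using (_∘_)
open import Function.Definitions using (Injective)
open import Relation.Binary.Construct.Closure.ReflexiveTransitive
  using (Star; ε; _◅_; _◅◅_; reverse)
open import Relation.Binary.Definitions using (tri<; tri≈; tri>)
open import Relation.Binary.PropositionalEquality hiding ([_])
open import Relation.Nullary.Decidable
  using (Dec; yes; no; does; _×-dec_; dec-true; dec-false)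
open import Relation.Nullary.Negation using (¬_; contradiction)
open import Relation.Unary using () renaming (Decidable to Decidable₁)

-- Lists and optional values

module _ {A : Set} where

  lookup-injective : {xs : List A} → Unique xs → ∀ i j →
                     lookup xs i ≡ lookup xs j → i ≡ j
  lookup-injective (_ ∷ _)    zero    zero    _  = refl
  lookup-injective (x∉ ∷ _)   zero    (suc j) eq =
    contradiction eq (lookupAll x∉ (∈-lookup j))
  lookup-injective (x∉ ∷ _)   (suc i) zero    eq =
    contradiction (sym eq) (lookupAll x∉ (∈-lookup i))
  lookup-injective (_ ∷ xs!)  (suc i) (suc j) eq =
    cong suc (lookup-injective xs! i j eq)

  -- A duplicate-free list is no longer than any list into which its entries can be
  -- matched injectively along a relation R.
  length-≤-matching :
    {B : Set} {R : A → B → Set} {xs : List A} {ys : List B} → Unique xs →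
    (∀ {x} → x ∈ˡ xs → ∃[ y ] (y ∈ˡ ys × R x y)) →
    (∀ {x x′ y} → x ∈ˡ xs → x′ ∈ˡ xs → R x y → R x′ y → x ≡ x′) →
    length xs ≤ length ys
  length-≤-matching {R = R} {xs} {ys} xs! partner inj = injective⇒≤ {f = f} f-injective
    where
    f : Fin (length xs) → Fin (length ys)
    f i = index (proj₁ (proj₂ (partner (∈-lookup i))))

    related : ∀ i → R (lookup xs i) (lookup ys (f i))
    related i = let _ , y∈ , xRy = partner (∈-lookup i)
                in subst (R _) (lookup-index y∈) xRy

    f-injective : Injective _≡_ _≡_ f
    f-injective {i} {j} eq = lookup-injective xs! i j
      (inj (∈-lookup i) (∈-lookup j) (related i)
        (subst (R _ ∘ lookup ys) (sym eq) (related j)))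

  -- If each entry of a nonempty list carries a time, some entry carries the latest one.
  latest : {R : A → ℕ → Set} (xs : List A) → length xs ≢ 0 →
           (∀ {y} → y ∈ˡ xs → ∃ (R y)) →
           ∃₂ λ y t → y ∈ˡ xs × R y t ×
             (∀ {z} → z ∈ˡ xs → ∃[ t′ ] (R z t′ × t′ ≤ t))
  latest []       ne _ = contradiction refl ne
  latest (x ∷ []) _  f = let t , Rxt = f (here refl) in
    x , t , here refl , Rxt , λ { (here refl) → t , Rxt , ≤-refl }
  latest (x ∷ xs@(_ ∷ _)) _ f
    with y , t₁ , y∈ , Ryt₁ , below ← latest xs (λ ()) (f ∘ there)
    with t , Rxt ← f (here refl)
    with ≤-total t t₁
  ... | inj₁ t≤t₁ = y , t₁ , there y∈ , Ryt₁ , λ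
    { (here refl) → t , Rxt , t≤t₁
    ; (there z∈)  → below z∈ }
  ... | inj₂ t₁≤t = x , t , here refl , Rxt , λ
    { (here refl) → t , Rxt , ≤-refl
    ; (there z∈)  → map₂ (map₂ (λ t′≤ → ≤-trans t′≤ t₁≤t)) (below z∈) }

  inhabited : (xs : List A) → length xs ≢ 0 → ∃[ x ] x ∈ˡ xs
  inhabited []      ne = contradiction refl ne
  inhabited (x ∷ _) _  = x , here refl

  nonempty : {x : A} {xs : List A} → x ∈ˡ xs → ∃₂ λ y ys → xs ≡ y ∷ ys
  nonempty {xs = y ∷ ys} _ = y , ys , refl

  unique-∈ : ∀ {x} (xs : List A) → unique xs ≡ just x → x ∈ˡ xs
  unique-∈ (_ ∷ []) refl = here refl

  module _ {B : Set} (f : A → Maybe B) where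

    ∈-mapMaybe⁻ : ∀ {y} xs → y ∈ˡ mapMaybe f xs → ∃[ x ] (x ∈ˡ xs × f x ≡ just y)
    ∈-mapMaybe⁻ (x ∷ xs) y∈ with f x in eq
    ∈-mapMaybe⁻ (x ∷ xs) y∈          | nothing =
      map₂ (map₁ there) (∈-mapMaybe⁻ xs y∈)
    ∈-mapMaybe⁻ (x ∷ xs) (here refl) | just _  = x , here refl , eq
    ∈-mapMaybe⁻ (x ∷ xs) (there y∈)  | just _  =
      map₂ (map₁ there) (∈-mapMaybe⁻ xs y∈)

    mapMaybe-none : ∀ xs → (∀ {x} → x ∈ˡ xs → f x ≡ nothing) → mapMaybe f xs ≡ []
    mapMaybe-none []       _    = refl
    mapMaybe-none (x ∷ xs) none rewrite none (here refl) =
      mapMaybe-none xs (none ∘ there)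

    mapMaybe-single : ∀ {x y xs} → Unique xs → x ∈ˡ xs → f x ≡ just y →
                      (∀ {x′} → x′ ∈ˡ xs → x ≢ x′ → f x′ ≡ nothing) →
                      mapMaybe f xs ≡ [ y ]
    mapMaybe-single (x∉ ∷ _) (here refl) fx others rewrite fx =
      cong (_ ∷_) (mapMaybe-none _ λ x′∈ → others (there x′∈) (lookupAll x∉ x′∈))
    mapMaybe-single (x∉ ∷ xs!) (there x∈) fx others
      rewrite others (here refl) (lookupAll x∉ x∈ ∘ sym) =
      mapMaybe-single xs! x∈ fx (others ∘ there)

  never-just : {x : Maybe A} → (∀ {y} → x ≢ just y) → x ≡ nothing
  never-just {just _}  never = contradiction refl never
  never-just {nothing} _     = refl

  ∈-fromMaybe : {x : Maybe A} {y : A} → x ≡ just y → y ∈ˡ fromMaybe x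
  ∈-fromMaybe refl = here refl

module _ {P A : Set} where

  if-yes : {x y : A} (P? : Dec P) → P → (if does P? then x else y) ≡ x
  if-yes P? p rewrite dec-true P? p = refl

  if-no : {x y : A} (P? : Dec P) → ¬ P → (if does P? then x else y) ≡ y
  if-no P? ¬p rewrite dec-false P? ¬p = refl

  if-just : {x : Maybe A} {y : A} (P? : Dec P) →
            (if does P? then x else nothing) ≡ just y → P × x ≡ just y
  if-just (yes p) eq = p , eq

-- Arithmetic

<2^[1+⌊log₂⌋] : ∀ n → n < 2 ^ suc ⌊log₂ n ⌋
<2^[1+⌊log₂⌋] n = ≰⇒> λ 2^≤n →
  1+n≰n (subst (_≤ ⌊log₂ n ⌋) (⌊log₂[2^n]⌋≡n _) (⌊log₂⌋-mono-≤ 2^≤n))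

mod3-step : ∀ n → suc n % 3 ≢ n % 3
mod3-step (suc (suc (suc n))) = mod3-step n

mod3-two-steps : ∀ n → suc (suc n) % 3 ≢ n % 3
mod3-two-steps (suc (suc (suc n))) = mod3-two-steps n

-- Levels of neighbours differ by at most one, so among the neighbours of a node of
-- level n, level n + 1 is recognised by its residue modulo 3.
mod3-determines : ∀ {m n} → m ≤ suc n → n ≤ suc m → m % 3 ≡ suc n % 3 → m ≡ suc n
mod3-determines {m} {n} m≤ n≤ eq with m≤n⇒m<n∨m≡n m≤
... | inj₂ m≡ = m≡
... | inj₁ (s≤s m≤n) with m≤n⇒m<n∨m≡n m≤n
...   | inj₂ refl = contradiction (sym eq) (mod3-step m)
...   | inj₁ m<n with refl ← ≤-antisym n≤ m<n = contradiction (sym eq) (mod3-two-steps m)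

-- Round m + q * 3 is round m of phase q.
[m+q*3]%3 : ∀ {m} q → m < 3 → (m + q * 3) % 3 ≡ m
[m+q*3]%3 {m} q m<3 = trans ([m+kn]%n≡m%n m q 3) (m<n⇒m%n≡m m<3)

[m+q*3]/3 : ∀ {m} q → m < 3 → (m + q * 3) / 3 ≡ q
[m+q*3]/3 {m} q m<3 = *-cancelʳ-≡ _ q 3 (+-cancelˡ-≡ m _ _ (begin
  m + (m + q * 3) / 3 * 3                      ≡⟨ cong (_+ (m + q * 3) / 3 * 3) ([m+q*3]%3 q m<3) ⟨
  (m + q * 3) % 3 + (m + q * 3) / 3 * 3        ≡⟨ m≡m%n+[m/n]*n (m + q * 3) 3 ⟨
  m + q * 3                                    ∎))
  where open ≡-Reasoning

least : {P : ℕ → Set} → Decidable₁ P → ∀ n → P n →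
        ∃[ m ] (m ≤ n × P m × (∀ {x} → x < m → ¬ P x))
least {P} P? = <-rec _ step
  where
  Least : ℕ → Set
  Least n = ∃[ m ] (m ≤ n × P m × (∀ {x} → x < m → ¬ P x))

  step : ∀ n → (∀ {m} → m < n → P m → Least m) → P n → Least n
  step n rec Pn with anyUpTo? P? n
  ... | yes (m , m<n , Pm) = let l , l≤m , rest = rec m<n Pm
                             in l , ≤-trans l≤m (<⇒≤ m<n) , rest
  ... | no none = n , ≤-refl , Pn , λ x<n Px → none (_ , x<n , Px)

modulo-small : ∀ {Δ s} k → s < Δ → (s + k * Δ) modulo Δ ≡ s
modulo-small {suc δ} {s} k s<Δ = trans ([m+kn]%n≡m%n s k (suc δ)) (m<n⇒m%n≡m s<Δ)

-- Phase s + k * Δ belongs to slot s and comes after t, so the closest such phase is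
-- not later.
closestPhase-exists : ∀ {Δ s t} k → s < Δ → t < k * Δ →
                      ∃[ q ] (ClosestPhase Δ s t q × q < suc k * Δ)
closestPhase-exists {Δ} {s} {t} k s<Δ t<kΔ =
  let q , q≤ , ok , first = least (λ x → (t <? x) ×-dec (x modulo Δ ≟ s)) (s + k * Δ)
        (<-≤-trans t<kΔ (m≤n+m _ s) , modulo-small k s<Δ)
  in q , (ok , λ x<q t<x eq → first x<q (t<x , eq)) ,
     ≤-<-trans q≤ (+-monoˡ-< (k * Δ) s<Δ)

closestPhase-unique : ∀ {Δ s t q q′} → ClosestPhase Δ s t q → ClosestPhase Δ s t q′ →
                      q ≡ q′
closestPhase-unique {q = q} {q′} ((t<q , q≡) , first) ((t<q′ , q′≡) , first′)
  with <-cmp q q′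
... | tri< q<q′ _ _ = contradiction q≡ (first′ q<q′ t<q)
... | tri≈ _ q≡q′ _ = q≡q′
... | tri> _ _ q′<q = contradiction q′≡ (first q′<q t<q′)

-- The binary encoding of labels

decodeᵇ-encodeᵇ : ∀ x bs → decodeᵇ (encodeᵇ x ++ bs) ≡ (x , bs)
decodeᵇ-encodeᵇ ℕᵇ.zero  bs = refl
decodeᵇ-encodeᵇ 2[1+ x ] bs = cong (map₁ 2[1+_]) (decodeᵇ-encodeᵇ x bs)
decodeᵇ-encodeᵇ 1+[2 x ] bs = cong (map₁ 1+[2_]) (decodeᵇ-encodeᵇ x bs)

-- The last number of a label is followed by nothing.
decodeᵇ-encodeᵇ-last : ∀ x → decodeᵇ (encodeᵇ x) ≡ (x , [])
decodeᵇ-encodeᵇ-last x =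
  trans (cong decodeᵇ (sym (++-identityʳ (encodeᵇ x)))) (decodeᵇ-encodeᵇ x [])

decode-encode : ∀ L → decode (encode L) ≡ L
decode-encode (labelData s c cp Δ ch l)
  rewrite decodeᵇ-encodeᵇ (ℕᵇ.fromℕ s)
            (encodeℕ c ++ encodeℕ cp ++ encodeℕ Δ ++ encodeℕ ch ++ encodeℕ l)
        | decodeᵇ-encodeᵇ (ℕᵇ.fromℕ c)
            (encodeℕ cp ++ encodeℕ Δ ++ encodeℕ ch ++ encodeℕ l)
        | decodeᵇ-encodeᵇ (ℕᵇ.fromℕ cp) (encodeℕ Δ ++ encodeℕ ch ++ encodeℕ l)
        | decodeᵇ-encodeᵇ (ℕᵇ.fromℕ Δ) (encodeℕ ch ++ encodeℕ l)
        | decodeᵇ-encodeᵇ (ℕᵇ.fromℕ ch) (encodeℕ l)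
        | decodeᵇ-encodeᵇ-last (ℕᵇ.fromℕ l)
        | toℕ-fromℕ s | toℕ-fromℕ c | toℕ-fromℕ cp
        | toℕ-fromℕ Δ | toℕ-fromℕ ch | toℕ-fromℕ l = refl

-- Every digit costs two bits and the end marker one; a number below 2 ^ d has at most
-- d digits.
length-encodeᵇ : ∀ x d → ℕᵇ.toℕ x < 2 ^ d → length (encodeᵇ x) ≤ suc (2 * d)
length-encodeᵇ ℕᵇ.zero  d       _ = s≤s z≤n
length-encodeᵇ 2[1+ x ] zero    (s≤s ())
length-encodeᵇ 1+[2 x ] zero    (s≤s ())
length-encodeᵇ 2[1+ x ] (suc d) lt = begin
  2 + length (encodeᵇ x)  ≤⟨ +-monoʳ-≤ 2 (length-encodeᵇ x d
                               (<-trans (n<1+n _) (*-cancelˡ-< 2 _ _ lt))) ⟩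
  2 + suc (2 * d)         ≡⟨ cong suc (*-suc 2 d) ⟨
  suc (2 * suc d)         ∎
  where open ≤-Reasoning
length-encodeᵇ 1+[2 x ] (suc d) lt = begin
  2 + length (encodeᵇ x)  ≤⟨ +-monoʳ-≤ 2 (length-encodeᵇ x d
                               (*-cancelˡ-< 2 _ _ (<-trans (n<1+n _) lt))) ⟩
  2 + suc (2 * d)         ≡⟨ cong suc (*-suc 2 d) ⟨
  suc (2 * suc d)         ∎
  where open ≤-Reasoning

length-encodeℕ : ∀ n d → n < 2 ^ d → length (encodeℕ n) ≤ suc (2 * d)
length-encodeℕ n d n<2^d =
  length-encodeᵇ (ℕᵇ.fromℕ n) d (subst (_< 2 ^ d) (sym (toℕ-fromℕ n)) n<2^d)

length-encode : ∀ L d → let open LabelData L in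
  slot < 2 ^ d → colour < 2 ^ d → parentColour < 2 ^ d →
  maxDegree < 2 ^ d → children < 2 ^ d → level3 < 2 ^ d →
  length (encode L) ≤ 6 * suc (2 * d)
length-encode (labelData s c cp Δ ch l) d s< c< cp< Δ< ch< l< =
  append s s< (append c c< (append cp cp< (append Δ Δ< (append ch ch<
    (≤-trans (length-encodeℕ l d l<) (m≤m+n _ 0))))))
  where
  append : ∀ {k} x {ys : List Bool} → x < 2 ^ d → length ys ≤ k →
           length (encodeℕ x ++ ys) ≤ suc (2 * d) + k
  append x {ys} x< ys≤ = subst (_≤ _) (sym (length-++ (encodeℕ x) {ys}))
    (+-mono-≤ (length-encodeℕ x d x<) ys≤)

-- Networks and BFS trees

module _ {n : ℕ} (G : Network n) where
  open Network G

  snoc : ∀ {d u v w} → Walk G d u v → Adj v w → Walk G (suc d) u w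
  snoc []       e = e ∷ []
  snoc (e′ ∷ p) e = e′ ∷ snoc p e

  neighbours-complete : ∀ {u v} → Adj u v → v ∈ˡ neighbours G u
  neighbours-complete {u} e = ∈-filter⁺ (adj? u) (∈-allFin _) e

  neighbours-sound : ∀ u {v} → v ∈ˡ neighbours G u → Adj u v
  neighbours-sound u v∈ = proj₂ (∈-filter⁻ (adj? u) {xs = allFin n} v∈)

  neighbours-unique : ∀ u → Unique (neighbours G u)
  neighbours-unique u = filter⁺ (adj? u) (allFin⁺ n)

module Tree {n : ℕ} {G : Network n} {r : Fin n} (T : BFSTree G r) where
  open Network G
  open BFSTree T public

  level-adjacent : ∀ {u v} → Adj u v → level v ≤ suc (level u)
  level-adjacent {u} {v} e =
    proj₂ (level-dist v) _ (snoc G (proj₁ (level-dist u)) e)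

  child-adj : ∀ {u v} → IsChild T u v → Adj u v
  child-adj (u≢r , refl) = parent-adj _ u≢r

  level-child : ∀ {u v} → IsChild T u v → level u ≡ suc (level v)
  level-child (u≢r , refl) = level-parent _ u≢r

  -- Ancestor u v: the node v lies in the subtree of u, which includes u itself; the
  -- path is read downwards from u.
  Ancestor : Fin n → Fin n → Set
  Ancestor = Star (λ x y → IsChild T y x)

  -- Climbing from v to its parent lowers the level, so the climb ends at the root.
  root-ancestor : ∀ v → Ancestor r v
  root-ancestor v = go (level v) v refl
    where
    go : ∀ ℓ v → level v ≡ ℓ → Ancestor r v
    go ℓ v eq with v ≟ᶠ r
    ... | yes refl = ε
    go zero    v eq | no v≢r = contradiction (trans (sym eq) (level-parent v v≢r)) 0≢1+n
    go (suc ℓ) v eq | no v≢r =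
      go ℓ (parent v) (suc-injective (trans (sym (level-parent v v≢r)) eq))
        ◅◅ (v≢r , refl) ◅ ε

  ancestor-split : ∀ {u v} → Ancestor u v →
                   u ≡ v ⊎ ∃[ w ] (IsChild T w u × Ancestor w v)
  ancestor-split ε       = inj₁ refl
  ancestor-split (c ◅ p) = inj₂ (_ , c , p)

  module _ {S : Subset n} where

    -- The set S contains the parent of each of its members other than the root.
    ParentClosed : Set
    ParentClosed = ∀ {u v} → IsChild T u v → u ∈ S → v ∈ S

    ancestor-∈ : ParentClosed → ∀ {u v} → Ancestor u v → v ∈ S → u ∈ S
    ancestor-∈ closed ε       v∈ = v∈
    ancestor-∈ closed (c ◅ p) v∈ = closed c (ancestor-∈ closed p v∈)

    -- Any two nodes are joined through the root.
    parentClosed⇒subtree : ParentClosed → IsSubtree T S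
    parentClosed⇒subtree closed u v u∈S v∈S =
      reverse turn (fromRoot (root-ancestor u) u∈S) ◅◅ fromRoot (root-ancestor v) v∈S
      where
      Edge : Fin n → Fin n → Set
      Edge x y = TreeEdge T x y × x ∈ S × y ∈ S

      turn : ∀ {x y} → Edge x y → Edge y x
      turn (inj₁ c , x∈ , y∈) = inj₂ c , y∈ , x∈
      turn (inj₂ c , x∈ , y∈) = inj₁ c , y∈ , x∈

      fromRoot : ∀ {x y} → Ancestor x y → y ∈ S → Star Edge x y
      fromRoot ε       _  = ε
      fromRoot (c ◅ p) y∈ =
        (inj₂ c , ancestor-∈ closed (c ◅ p) y∈ , ancestor-∈ closed p y∈) ◅ fromRoot p y∈

    -- A path in S from u to the root has to leave the subtree of u, and the only tree edge
    -- that does so leads to the parent of u.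
    subtree⇒parentClosed : r ∈ S → IsSubtree T S → ParentClosed
    subtree⇒parentClosed r∈S subtree {u} {v} (u≢r , refl) u∈S =
      leave (subtree u r u∈S r∈S) ε
      where
      Up : Fin n → Fin n → Set
      Up = Star (IsChild T)

      up-root : ∀ {x} → Up r x → x ≡ r
      up-root ε              = refl
      up-root ((r≢r , _) ◅ _) = contradiction refl r≢r

      -- The path has reached x, which is still in the subtree of u.
      leave : ∀ {x} → Star (λ x y → TreeEdge T x y × x ∈ S × y ∈ S) x r →
              Up x u → parent u ∈ S
      leave ε p = contradiction (up-root p) u≢r
      leave ((inj₂ c , _ , _) ◅ w) p = leave w (c ◅ p)
      leave ((inj₁ (_ , refl) , _ , y∈S) ◅ w) ε = y∈S
      leave ((inj₁ (_ , refl) , _ , _) ◅ w) ((_ , refl) ◅ p) = leave w p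

  -- Otherwise removing the leaf would give a smaller subtree containing the root and all
  -- sources.
  leaf-is-source : ∀ {k} {source : Fin k → Fin n} {T′ : Subset n} →
    IsSmallestSubtree T source T′ →
    ∀ {v} → v ∈ T′ → v ≢ r → (∀ {u} → IsChild T u v → ¬ u ∈ T′) → ∃[ i ] source i ≡ v
  leaf-is-source {source = source} {T′} ((subtree , r∈ , sources∈) , smallest) {v} v∈ v≢r leaf
    with any? (λ i → source i ≟ᶠ v)
  ... | yes i,eq = i,eq
  ... | no ¬source =
    contradiction (x∈⁅x⁆ v)
      (x∈∁p⇒x∉p (proj₂ (x∈p∩q⁻ T′ _ (smallest T′-v T′-v-spans v∈))))
    where
    T′-v : Subset n
    T′-v = T′ ∩ ∁ ⁅ v ⁆

    keep : ∀ {x} → x ∈ T′ → x ≢ v → x ∈ T′-v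
    keep x∈ x≢v = x∈p∩q⁺ (x∈ , x∉p⇒x∈∁p (x≢y⇒x∉⁅y⁆ x≢v))

    T′-v-spans : Spans T source T′-v
    T′-v-spans =
      parentClosed⇒subtree (λ c u∈ →
        let u∈T′ = proj₁ (x∈p∩q⁻ T′ _ u∈) in
        keep (subtree⇒parentClosed r∈ subtree c u∈T′)
             (λ { refl → leaf c u∈T′ })) ,
      keep r∈ (v≢r ∘ sym) ,
      λ i → keep (sources∈ i) (λ eq → ¬source (i , eq))

-- The children in T′, as enumerated by childCount.
module Kids {n : ℕ} {G : Network n} {r : Fin n} (T : BFSTree G r) (T′ : Subset n) where

  private
    isKid? : ∀ v → Decidable₁ (λ u → IsChild T u v × u ∈ T′)
    isKid? v u = isChild? T u v ×-dec (u ∈? T′)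

  kids : Fin n → List (Fin n)
  kids v = filter (isKid? v) (allFin n)

  kid-complete : ∀ {u v} → IsChild T u v → u ∈ T′ → u ∈ˡ kids v
  kid-complete {u} {v} child u∈ = ∈-filter⁺ (isKid? v) (∈-allFin u) (child , u∈)

  kid-sound : ∀ {u v} → u ∈ˡ kids v → IsChild T u v × u ∈ T′
  kid-sound {u} {v} u∈ = proj₂ (∈-filter⁻ (isKid? v) {xs = allFin n} u∈)

  kids-unique : ∀ v → Unique (kids v)
  kids-unique v = filter⁺ (isKid? v) (allFin⁺ n)

-- Executions of a protocol

-- The first of two timed entries has the later time.
LaterThan : {A : Set} → ℕ × A → ℕ × A → Set
LaterThan e e′ = proj₁ e′ < proj₁ e

head-latest : ∀ {A : Set} {e e′ : ℕ × A} {es} → AllPairs LaterThan (e ∷ es) →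
              e′ ∈ˡ e ∷ es → proj₁ e′ ≤ proj₁ e
head-latest _            (here refl) = ≤-refl
head-latest (earlier ∷ _) (there e′∈) = <⇒≤ (lookupAll earlier e′∈)

module _ {n : ℕ} (G : Network n) (P : Protocol) (label : Fin n → List Bool)
         {M : Set} (own : Fin n → Maybe M) where
  open Network G
  open Protocol P
  open Execution G P label own

  -- In round t, node v transmits the message m.
  record Sends (t : ℕ) (v : Fin n) (m : Message Control M) : Set where
    constructor mkSends
    field sends : transmission (history t) t v ≡ just m

  -- In round t, node v receives the message m.
  record Hears (t : ℕ) (v : Fin n) (m : Message Control M) : Set where
    constructor mkHears
    field hears : reception (history t) t v ≡ just m

  -- What is received was transmitted by a neighbour.
  heard-sound : ∀ {t v m} → Hears t v m → ∃[ w ] (Adj v w × Sends t w m)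
  heard-sound {t} {v} (mkHears eq) with transmission (history t) t v
  ... | nothing =
    let w , w∈ , eq′ = ∈-mapMaybe⁻ (transmission (history t) t) (neighbours G v) (unique-∈ _ eq)
    in w , neighbours-sound G v w∈ , mkSends eq′

  -- A listening node receives the message of its only transmitting neighbour.
  heard-complete : ∀ {t v w m} → (∀ {m′} → ¬ Sends t v m′) → Adj v w → Sends t w m →
                   (∀ {w′ m′} → Adj v w′ → Sends t w′ m′ → w′ ≡ w) →
                   Hears t v m
  heard-complete {t} {v} {w} {m} quiet e (mkSends sends) alone = mkHears hears
    where
    hears : reception (history t) t v ≡ just m
    hears with transmission (history t) t v | never-just (λ eq → quiet (mkSends eq))
    ... | nothing | refl =
      cong unique (mapMaybe-single (transmission (history t) t) (neighbours-unique G v)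
        (neighbours-complete G e) sends
        (λ w′∈ w≢w′ → never-just
          (λ eq → w≢w′ (sym (alone (neighbours-sound G v w′∈) (mkSends eq))))))

  history-complete : ∀ {t t′ v m} → Hears t v m → t < t′ → (t , m) ∈ˡ history t′ v
  history-complete {t} {suc t′} h@(mkHears eq) (s≤s t≤t′) with m≤n⇒m<n∨m≡n t≤t′
  ... | inj₁ t<t′ = ∈-++⁺ʳ _ (history-complete h t<t′)
  ... | inj₂ refl = ∈-++⁺ˡ (∈-fromMaybe (cong (Maybe.map (t ,_)) eq))

  history-sound : ∀ {t t′ v m} → (t , m) ∈ˡ history t′ v → t < t′ × Hears t v m
  history-sound {t} {suc t′} {v} e∈ with reception (history t′) t′ v in eq | e∈
  ... | nothing | e∈        = map₁ m<n⇒m<1+n (history-sound e∈)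
  ... | just _  | here refl = n<1+n t , mkHears eq
  ... | just _  | there e∈  = map₁ m<n⇒m<1+n (history-sound e∈)

  history-latestFirst : ∀ t v → AllPairs LaterThan (history t v)
  history-latestFirst zero    v = []
  history-latestFirst (suc t) v with reception (history t) t v
  ... | nothing = history-latestFirst t v
  ... | just _  = tabulate (proj₁ ∘ history-sound) ∷ history-latestFirst t v

-- The transmission rule

module _ {M : Set} where

  transmitA-sound : ∀ L (own : Maybe M) h t {m} → transmitA L own h t ≡ just m →
    t % 3 ≡ LabelData.level3 L ×
    Message.control m ≡ colours (LabelData.colour L) (LabelData.parentColour L) ×
    phaseContent L own h (t / 3) ≡ just (Message.content m)
  transmitA-sound L own h t eq
    with t≡ , eq′ ← if-just (t % 3 ≟ LabelData.level3 L) eq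
    with phaseContent L own h (t / 3) | eq′
  ... | just _ | refl = t≡ , refl , refl

  transmitA-complete : ∀ L (own : Maybe M) h t {ms} → t % 3 ≡ LabelData.level3 L →
    phaseContent L own h (t / 3) ≡ just ms →
    transmitA L own h t ≡
    just (message (colours (LabelData.colour L) (LabelData.parentColour L)) ms)
  transmitA-complete L own h t t≡ eq =
    trans (if-yes (t % 3 ≟ LabelData.level3 L) t≡) (cong (Maybe.map _) eq)

  module _ (L : LabelData) (own : Maybe M) (h : History Colours M) (p : ℕ) where
    open LabelData L

    -- The result of innerContent, given the list of receptions from children; only the
    -- latest one, at its head, matters.  The count of heard children is not
    -- recomputed from that list.
    innerContentFrom : History Colours M → Maybe (List M)
    innerContentFrom []      = nothing
    innerContentFrom (e ∷ _) =
      if does ((heardChildren L own h ≟ children) ×-dec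
               closestPhase? maxDegree slot (proj₁ e / 3) p)
      then just (fromMaybe own ++ concatMap (Message.content ∘ proj₂) h)
      else nothing

    innerContent≡ : innerContent L own h p ≡ innerContentFrom (childReceptions L own h)
    innerContent≡ with childReceptions L own h
    ... | []    = refl
    ... | _ ∷ _ = refl

    innerContent-sound : ∀ {ms} → innerContent L own h p ≡ just ms →
      ∃₂ λ e es → childReceptions L own h ≡ e ∷ es ×
        heardChildren L own h ≡ children ×
        ClosestPhase maxDegree slot (proj₁ e / 3) p
    innerContent-sound eq = from _ refl (trans (sym innerContent≡) eq)
      where
      from : ∀ {ms} es′ → childReceptions L own h ≡ es′ → innerContentFrom es′ ≡ just ms →
             ∃₂ λ e es → childReceptions L own h ≡ e ∷ es ×
               heardChildren L own h ≡ children ×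
               ClosestPhase maxDegree slot (proj₁ e / 3) p
      from (e ∷ es) receptions eq
        with (heard≡ , closest) , _ ← if-just ((heardChildren L own h ≟ children) ×-dec
               closestPhase? maxDegree slot (proj₁ e / 3) p) eq
        = e , es , receptions , heard≡ , closest

    innerContent-complete : ∀ {e es} →
      childReceptions L own h ≡ e ∷ es →
      heardChildren L own h ≡ children →
      ClosestPhase maxDegree slot (proj₁ e / 3) p →
      innerContent L own h p ≡
      just (fromMaybe own ++ concatMap (Message.content ∘ proj₂) h)
    innerContent-complete {e} receptions heard≡ closest =
      trans innerContent≡ (trans (cong innerContentFrom receptions)
        (if-yes ((heardChildren L own h ≟ children) ×-dec
                 closestPhase? maxDegree slot (proj₁ e / 3) p) (heard≡ , closest)))

  -- A sleeping node would not transmit even if it followed the algorithm, so being awake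
  -- can be ignored below.
  transmitA-asleep : ∀ L {t} → transmitA {M} L nothing [] t ≡ nothing
  transmitA-asleep L {t} = trans
    (cong (λ x → if does (t % 3 ≟ LabelData.level3 L) then Maybe.map _ x else nothing)
      (trans (cong (λ x → if does (LabelData.children L ≟ 0) then x else nothing)
               (if-eta (does (t / 3 ≟ LabelData.slot L))))
             (if-eta (does (LabelData.children L ≟ 0)))))
    (if-eta (does (t % 3 ≟ LabelData.level3 L)))

  awake-transmitA : ∀ L (own : Maybe M) h t →
    (if awake own h then transmitA L own h t else nothing) ≡ transmitA L own h t
  awake-transmitA L (just _) h       t = refl
  awake-transmitA L nothing  (_ ∷ _) t = refl
  awake-transmitA L nothing  []      t = sym (transmitA-asleep L {t})

-- The execution of the algorithm

-- The labels enter only through the data that a node decodes from its own label.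
module Gathering {n D Δ k m : ℕ} {G : Network n} {r : Fin n} {source : Fin k → Fin n}
  (diameter : IsDiameter G D)
  (source-injective : Injective _≡_ _≡_ source)
  (T : BFSTree G r) {T′ : Subset n} (smallest : IsSmallestSubtree T source T′)
  {s : Fin n → Fin Δ} (slots : IsSlotAssignment T s)
  {c : Fin n → Fin m} (colouring : IsDistanceTwoColouring G c)
  (label : Fin n → List Bool)
  (label-decodes : ∀ v → decode (label v) ≡
    labelData (toℕ (s v)) (toℕ (c v)) (toℕ (c (BFSTree.parent T v))) Δ
              (childCount T T′ v) (BFSTree.level T v % 3))
  {M : Set} (msg : Fin k → M)
  where

  open Network G
  open Tree T
  open Kids T T′

  own : Fin n → Maybe M
  own = sourceMessage source msg

  L : Fin n → LabelData
  L v = labelData (toℕ (s v)) (toℕ (c v)) (toℕ (c (parent v))) Δ (childCount T T′ v)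
                  (level v % 3)

  hist : ℕ → Fin n → History Colours M
  hist = Execution.history G algorithmA label own

  -- Transmission and reception: round, node and message.
  Tx Rx : ℕ → Fin n → Message Colours M → Set
  Tx = Sends G algorithmA label own
  Rx = Hears G algorithmA label own

  T′-closed : ParentClosed {T′}
  T′-closed = subtree⇒parentClosed (proj₁ (proj₂ (proj₁ smallest))) (proj₁ (proj₁ smallest))

  source∈T′ : ∀ i → source i ∈ T′
  source∈T′ = proj₂ (proj₂ (proj₁ smallest))

  own-source : ∀ i → own (source i) ≡ just (msg i)
  own-source i with any? (λ j → source j ≟ᶠ source i)
  ... | yes (_ , eq) = cong (just ∘ msg) (source-injective eq)
  ... | no none      = contradiction (i , refl) none

  own-just : ∀ {v x} → own v ≡ just x → ∃[ i ] source i ≡ v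
  own-just {v} eq with any? (λ j → source j ≟ᶠ v)
  ... | yes i,eq = i,eq

  tx≡ : ∀ t v →
    Execution.transmission G algorithmA label own
      (Execution.history G algorithmA label own t) t v ≡
    transmitA (L v) (own v) (hist t v) t
  tx≡ t v = trans (awake-transmitA (decode (label v)) (own v) (hist t v) t)
    (cong (λ l → transmitA l (own v) (hist t v) t) (label-decodes v))

  -- The colours that v appends to its message.
  control : Fin n → Colours
  control v = colours (toℕ (c v)) (toℕ (c (parent v)))

  -- What v has to transmit in the phase containing round t, if anything.
  phase : ℕ → Fin n → Maybe (List M)
  phase t v = phaseContent (L v) (own v) (hist t v) (t / 3)

  tx-phase : ∀ {t v μ} → Tx t v μ →
    t % 3 ≡ level v % 3 × Message.control μ ≡ control v ×
    phase t v ≡ just (Message.content μ)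
  tx-phase {t} {v} {μ} (mkSends eq) =
    transmitA-sound (L v) (own v) (hist t v) t {μ} (trans (sym (tx≡ t v)) eq)

  phase-tx : ∀ {t v ms} → t % 3 ≡ level v % 3 → phase t v ≡ just ms →
    Tx t v (message (control v) ms)
  phase-tx {t} {v} {ms} t≡ eq =
    mkSends (trans (tx≡ t v) (transmitA-complete (L v) (own v) (hist t v) t {ms} t≡ eq))

  leaf-phase : ∀ t v → childCount T T′ v ≡ 0 →
               phase t v ≡ leafContent (L v) (own v) (hist t v) (t / 3)
  leaf-phase t v leaf = if-yes (childCount T T′ v ≟ 0) leaf

  inner-phase : ∀ t v → childCount T T′ v ≢ 0 →
                phase t v ≡ innerContent (L v) (own v) (hist t v) (t / 3)
  inner-phase t v inner = if-no (childCount T T′ v ≟ 0) inner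

  leaf-phase-sound : ∀ t v {ms} → childCount T T′ v ≡ 0 → phase t v ≡ just ms →
                     t / 3 ≡ toℕ (s v) × ∃[ i ] source i ≡ v
  leaf-phase-sound t v {ms} leaf eq =
    let p≡ , eq′ = if-just (t / 3 ≟ toℕ (s v)) (trans (sym (leaf-phase t v leaf)) eq)
    in p≡ , from (own v) refl eq′
    where
    from : ∀ o → own v ≡ o → Maybe.map [_] o ≡ just ms → ∃[ i ] source i ≡ v
    from (just _) own≡ _ = own-just own≡

  inner-phase-sound : ∀ t v {ms} → childCount T T′ v ≢ 0 → phase t v ≡ just ms →
    ∃₂ λ e es → childReceptions (L v) (own v) (hist t v) ≡ e ∷ es ×
      heardChildren (L v) (own v) (hist t v) ≡ childCount T T′ v ×
      ClosestPhase Δ (toℕ (s v)) (proj₁ e / 3) (t / 3)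
  inner-phase-sound t v {ms} inner eq =
    innerContent-sound (L v) (own v) (hist t v) (t / 3) {ms}
      (trans (sym (inner-phase t v inner)) eq)

  -- What every transmission of a node v in a round t satisfies: it respects the level and
  -- the slot of v, carries the colours of v, and v belongs to T′.
  record ValidTransmission (v : Fin n) (t : ℕ) (μ : Message Colours M) : Set where
    constructor valid
    field
      level≡  : t % 3 ≡ level v % 3
      slot≡   : (t / 3) modulo Δ ≡ toℕ (s v)
      colour≡ : Message.control μ ≡ control v
      v∈T′    : v ∈ T′

  -- The phase of a leaf is its slot, which is below Δ and so equals its own residue.  A
  -- node outside T′ is not a source and, T′ being closed under parents, has no child in
  -- T′, so it stays silent.
  tx-sound : ∀ {t v μ} → Tx t v μ → ValidTransmission v t μ
  tx-sound {t} {v} tx with level≡ , colour≡ , content≡ ← tx-phase tx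
    with childCount T T′ v ≟ 0
  ... | yes leaf =
    let p≡ , i , eq = leaf-phase-sound t v leaf content≡
    in valid level≡
        (trans (cong (_modulo Δ) (trans p≡ (sym (+-identityʳ _))))
               (modulo-small 0 (toℕ<n (s v))))
        colour≡ (subst (_∈ T′) eq (source∈T′ i))
  ... | no inner =
    let _ , _ , _ , _ , ((_ , slot≡) , _) = inner-phase-sound t v inner content≡
        u , u∈ = inhabited (kids v) inner
    in valid level≡ slot≡ colour≡
        (T′-closed (proj₁ (kid-sound u∈)) (proj₂ (kid-sound u∈)))

  -- No collision: a neighbour w of the parent v that transmits together with a child u of
  -- v has the same level as u, by the residues modulo 3, and the same slot; the slot
  -- assignment excludes w unless it is u.  Nor does v transmit, as its level has another
  -- residue.
  parent-hears : ∀ {t u v μ} → IsChild T u v → Tx t u μ → Rx t v μ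
  parent-hears {t} {u} {v} child@(_ , refl) sends =
    heard-complete G algorithmA label own
      (λ eq → mod3-step (level v)
        (trans (sym level-u) (trans (sym (level≡ (tx-sound sends))) (level≡ (tx-sound eq)))))
      (symmetric (child-adj child)) sends alone
    where
    open ValidTransmission
    level-u : level u % 3 ≡ suc (level v) % 3
    level-u = cong (_% 3) (level-child child)

    alone : ∀ {w μ′} → Adj v w → Tx t w μ′ → w ≡ u
    alone {w} e eq with w ≟ᶠ u
    ... | yes w≡u = w≡u
    ... | no  w≢u = contradiction (symmetric e) (proj₂ slots w u w≢u
      (trans (mod3-determines (level-adjacent e) (level-adjacent (symmetric e))
                (trans (sym (level≡ (tx-sound eq))) (trans (level≡ (tx-sound sends)) level-u)))
             (sym (level-child child)))
      (toℕ-injective (trans (sym (slot≡ (tx-sound eq))) (slot≡ (tx-sound sends)))))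

  -- The receptions before round t that v attributes to its children.
  childRx : ℕ → Fin n → History Colours M
  childRx t v = childReceptions (L v) (own v) (hist t v)

  childRx-complete : ∀ {t t′ u v μ} → IsChild T u v → Tx t u μ → t < t′ →
                     (t , μ) ∈ˡ childRx t′ v
  childRx-complete {v = v} child@(_ , refl) sends t<t′ =
    ∈-filter⁺ (λ e → Colours.senderParent (Message.control (proj₂ e)) ≟ toℕ (c v))
      (history-complete G algorithmA label own
        (parent-hears child sends) t<t′)
      (cong Colours.senderParent (ValidTransmission.colour≡ (tx-sound sends)))

  -- Colours identify the sender as a child: if w is a neighbour of v and its parent has
  -- the colour of v, that parent is within distance 2 of v and hence is v.
  childRx-sound : ∀ {t t′ v μ} → (t , μ) ∈ˡ childRx t′ v →
                  ∃[ u ] (u ∈ˡ kids v × Tx t u μ × t < t′)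
  childRx-sound {t} {t′} {v} e∈
    with e∈h , colour-v ← ∈-filter⁻
           (λ e → Colours.senderParent (Message.control (proj₂ e)) ≟ toℕ (c v))
           {xs = hist t′ v} e∈
    with t<t′ , hears ← history-sound G algorithmA label own e∈h
    with w , v~w , sends ← heard-sound G algorithmA label own {t} {v} hears
    = w , kid-complete (w≢r , parent-w) v∈T′ , sends , t<t′
    where
    open ValidTransmission (tx-sound sends)
    same : c (parent w) ≡ c v
    same = toℕ-injective (trans (sym (cong Colours.senderParent colour≡)) colour-v)

    near : DistanceAtMost G 2 (parent w) v
    -- The root counts as its own parent; v is then adjacent to that parent.
    near with w ≟ᶠ r
    ... | yes refl rewrite parent-root = 1 , s≤s z≤n , symmetric v~w ∷ []
    ... | no w≢r = 2 , ≤-refl , symmetric (parent-adj w w≢r) ∷ symmetric v~w ∷ []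

    parent-w : parent w ≡ v
    parent-w with parent w ≟ᶠ v
    ... | yes eq = eq
    ... | no neq = contradiction same (colouring _ _ neq near)

    w≢r : w ≢ r
    w≢r refl = loopless (trans (sym parent-w) parent-root) v~w

  childRx-latestFirst : ∀ t v → AllPairs LaterThan (childRx t v)
  childRx-latestFirst t v = AllPairs.filter⁺
    (λ e → Colours.senderParent (Message.control (proj₂ e)) ≟ toℕ (c v))
    (history-latestFirst G algorithmA label own t v)

  -- Two different children of v are within distance 2 of each other.
  kids-distinct : ∀ {u u′ v} → u ∈ˡ kids v → u′ ∈ˡ kids v → c u ≡ c u′ → u ≡ u′
  kids-distinct {u} {u′} u∈ u′∈ eq with u ≟ᶠ u′
  ... | yes u≡u′ = u≡u′
  ... | no  u≢u′ = contradiction eq (colouring u u′ u≢u′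
    (2 , ≤-refl , child-adj (proj₁ (kid-sound u∈)) ∷
                  symmetric (child-adj (proj₁ (kid-sound u′∈))) ∷ []))

  senderOf : ℕ × Message Colours M → ℕ
  senderOf = Colours.sender ∘ Message.control ∘ proj₂

  -- The distinct sender colours that heardChildren counts.
  heardColours : ℕ → Fin n → List ℕ
  heardColours t v = deduplicate _≟_ (map senderOf (childRx t v))

  heardColours-sound : ∀ {t v a} → a ∈ˡ heardColours t v →
    ∃[ u ] (u ∈ˡ kids v × a ≡ toℕ (c u) × ∃₂ λ t′ μ → Tx t′ u μ × t′ < t)
  heardColours-sound {t} {v} a∈ =
    let (t′ , μ) , e∈ , a≡ = ∈-map⁻ senderOf
          (∈-deduplicate⁻ _≟_ (map senderOf (childRx t v)) a∈)
        u , u∈ , tx , t′<t = childRx-sound {t′} {t} {v} {μ} e∈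
    in u , u∈ , trans a≡ (cong Colours.sender (ValidTransmission.colour≡ (tx-sound tx))) ,
       t′ , μ , tx , t′<t

  heardColours-complete : ∀ {t t′ u v μ} → IsChild T u v → Tx t u μ → t < t′ →
                          toℕ (c u) ∈ˡ heardColours t′ v
  heardColours-complete {t} {t′} {u} {v} {μ} child tx t<t′ =
    ∈-deduplicate⁺ _≟_ {map senderOf (childRx t′ v)}
      (subst (_∈ˡ map senderOf (childRx t′ v))
        (cong Colours.sender (ValidTransmission.colour≡ (tx-sound tx)))
        (∈-map⁺ senderOf (childRx-complete child tx t<t′)))

  heardColours-unique : ∀ t v → Unique (heardColours t v)
  heardColours-unique t v = deduplicate-! _≟_ (map senderOf (childRx t v))

  -- As long as some child has not transmitted, the count of heard children is short: its
  -- colour can be added to the heard ones without exceeding the colours of the children.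
  heardChildren-< : ∀ t v {u} → u ∈ˡ kids v → (∀ {t′ μ} → Tx t′ u μ → t ≤ t′) →
                    heardChildren (L v) (own v) (hist t v) < childCount T T′ v
  heardChildren-< t v {u} u∈ late = length-≤-matching
    {R = λ a w → a ≡ toℕ (c w)} {toℕ (c u) ∷ heardColours t v} {kids v}
    (tabulate missing ∷ heardColours-unique t v) partner
    (λ _ _ a≡ a′≡ → trans a≡ (sym a′≡))
    where
    missing : ∀ {a} → a ∈ˡ heardColours t v → toℕ (c u) ≢ a
    missing {a} a∈ eq =
      let w , w∈ , a≡ , t′ , μ , tx , t′<t = heardColours-sound {t} {v} {a} a∈
          u≡w = kids-distinct u∈ w∈ (toℕ-injective (trans eq a≡))
      in <⇒≱ t′<t (late (subst (λ x → Tx t′ x μ) (sym u≡w) tx))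

    partner : ∀ {a} → a ∈ˡ toℕ (c u) ∷ heardColours t v →
              ∃[ w ] (w ∈ˡ kids v × a ≡ toℕ (c w))
    partner     (here a≡)  = u , u∈ , a≡
    partner {a} (there a∈) = let w , w∈ , a≡ , _ = heardColours-sound {t} {v} {a} a∈
                             in w , w∈ , a≡

  -- Once all children have transmitted, the heard colours are those of the children.
  heardChildren-≡ : ∀ t v → (∀ {u} → u ∈ˡ kids v → ∃₂ λ t′ μ → Tx t′ u μ × t′ < t) →
                    heardChildren (L v) (own v) (hist t v) ≡ childCount T T′ v
  heardChildren-≡ t v early = ≤-antisym
    (length-≤-matching {R = λ a w → a ≡ toℕ (c w)} {heardColours t v} {kids v}
      (heardColours-unique t v)
      (λ {a} a∈ → let w , w∈ , a≡ , _ = heardColours-sound {t} {v} {a} a∈ in w , w∈ , a≡)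
      (λ _ _ a≡ a′≡ → trans a≡ (sym a′≡)))
    (length-≤-matching {R = λ w a → a ≡ toℕ (c w)} {kids v} {heardColours t v}
      (kids-unique v)
      (λ {w} w∈ → let t′ , μ , tx , t′<t = early w∈ in
        toℕ (c w) ,
        heardColours-complete {t′} {t} {w} {v} {μ} (proj₁ (kid-sound w∈)) tx t′<t ,
        refl)
      (λ w∈ w′∈ a≡ a≡′ → kids-distinct w∈ w′∈ (toℕ-injective (trans (sym a≡) a≡′))))

  -- Round t is the only one in which v transmits, and the message then contains the
  -- messages of all sources in the subtree of v.
  OnlyTransmission : Fin n → ℕ → Set
  OnlyTransmission v t = ∃[ μ ] (Tx t v μ ×
    (∀ {t′ μ′} → Tx t′ v μ′ → t′ ≡ t) ×
    (∀ i → Ancestor v (source i) → msg i ∈ˡ Message.content μ))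

  -- The only transmission of v is in round t, within the first κ * Δ phases.
  DoneBy : ℕ → Fin n → ℕ → Set
  DoneBy κ v t = OnlyTransmission v t × t / 3 < κ * Δ

  -- The round of phase q in which v may transmit.
  round : ℕ → Fin n → ℕ
  round q v = level v % 3 + q * 3

  round%3 : ∀ q v → round q v % 3 ≡ level v % 3
  round%3 q v = [m+q*3]%3 q (m%n<n (level v) 3)

  round/3 : ∀ q v → round q v / 3 ≡ q
  round/3 q v = [m+q*3]/3 q (m%n<n (level v) 3)

  round-unique : ∀ {t v} → t % 3 ≡ level v % 3 → t ≡ round (t / 3) v
  round-unique {t} t≡ = trans (m≡m%n+[m/n]*n t 3) (cong (_+ t / 3 * 3) t≡)

  leaf-transmits : ∀ κ {v} → v ∈ T′ → v ≢ r → childCount T T′ v ≡ 0 → ∃ (DoneBy (suc κ) v)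
  leaf-transmits κ {v} v∈ v≢r leaf
    with i , refl ← leaf-is-source smallest v∈ v≢r
           (λ child u∈ → contradiction leaf (≢-sym (<⇒≢ (∈-length (kid-complete child u∈)))))
    = t , (_ , sends , only , collected) ,
      subst (_< suc κ * Δ) (sym (round/3 _ v)) (<-≤-trans (toℕ<n (s v)) (m≤m+n Δ (κ * Δ)))
    where
    t = round (toℕ (s v)) v

    sends : Tx t v (message (control v) [ msg i ])
    sends = phase-tx (round%3 (toℕ (s v)) v)
      (trans (leaf-phase t v leaf)
        (trans (if-yes (t / 3 ≟ toℕ (s v)) (round/3 (toℕ (s v)) v))
               (cong (Maybe.map [_]) (own-source i))))

    only : ∀ {t′ μ′} → Tx t′ v μ′ → t′ ≡ t
    only {t′} tx =
      let level≡ , _ , content≡ = tx-phase tx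
      in trans (round-unique level≡)
           (cong (λ q → round q v) (proj₁ (leaf-phase-sound t′ v leaf content≡)))

    collected : ∀ j → Ancestor v (source j) → msg j ∈ˡ [ msg i ]
    collected j p with ancestor-split p
    ... | inj₁ eq rewrite source-injective eq = here refl
    ... | inj₂ (u , child , q) = contradiction leaf (≢-sym (<⇒≢ (∈-length
      (kid-complete child (ancestor-∈ T′-closed q (source∈T′ j))))))

  -- If all children of v in T′ have transmitted before round t, then in round t node v knows the
  -- messages of all sources in its subtree.
  gathered : ∀ {t v} →
    (∀ {u} → u ∈ˡ kids v → ∃[ t′ ] (OnlyTransmission u t′ × t′ < t)) →
    ∀ i → Ancestor v (source i) →
    msg i ∈ˡ fromMaybe (own v) ++ concatMap (Message.content ∘ proj₂) (hist t v)
  gathered {t} {v} done i p with ancestor-split p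
  ... | inj₁ refl = ∈-++⁺ˡ (∈-fromMaybe (own-source i))
  ... | inj₂ (u , child , q)
    with t′ , (_ , sends , _ , collected) , t′<t ←
           done (kid-complete child (ancestor-∈ T′-closed q (source∈T′ i)))
    = ∈-++⁺ʳ (fromMaybe (own v)) (∈-concatMap⁺ (Message.content ∘ proj₂)
        (mapAny (λ { refl → collected i q })
          (history-complete G algorithmA label own
            (parent-hears child sends) t′<t)))

  -- A node v with children in T′, all of which transmit exactly once.  Among them u₀
  -- transmits last, in round t₀.
  module _ {κ v} (inner : childCount T T′ v ≢ 0)
           (done : ∀ {u} → u ∈ˡ kids v → ∃ (DoneBy κ u)) where

    private
      last = latest (kids v) inner done
      u₀   = proj₁ last
      t₀   = proj₁ (proj₂ last)
      u₀∈  = proj₁ (proj₂ (proj₂ last))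
      done₀ = proj₁ (proj₂ (proj₂ (proj₂ last)))

    done≤ : ∀ {u} → u ∈ˡ kids v → ∃[ t ] (DoneBy κ u t × t ≤ t₀)
    done≤ = proj₂ (proj₂ (proj₂ (proj₂ last)))

    μ₀ : Message Colours M
    μ₀ = proj₁ (proj₁ done₀)

    tx₀ : Tx t₀ u₀ μ₀
    tx₀ = proj₁ (proj₂ (proj₁ done₀))

    child₀ : IsChild T u₀ v
    child₀ = proj₁ (kid-sound u₀∈)

    heard-too-few : ∀ {t} → t ≤ t₀ → heardChildren (L v) (own v) (hist t v) ≢ childCount T T′ v
    heard-too-few {t} t≤t₀ = <⇒≢ (heardChildren-< t v u₀∈ late)
      where
      late : ∀ {t′ μ} → Tx t′ u₀ μ → t ≤ t′
      late tx with (_ , _ , only , _) , _ ← done₀ = subst (t ≤_) (sym (only tx)) t≤t₀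

    heard-all : ∀ {t} → t₀ < t → heardChildren (L v) (own v) (hist t v) ≡ childCount T T′ v
    heard-all {t} t₀<t = heardChildren-≡ t v λ u∈ →
      let t′ , ((μ , tx , _) , _) , t′≤ = done≤ u∈ in t′ , μ , tx , ≤-<-trans t′≤ t₀<t

    latest-reception : ∀ {t e es} → t₀ < t → childRx t v ≡ e ∷ es → proj₁ e ≡ t₀
    latest-reception {t} {e} {es} t₀<t eq = ≤-antisym upper
      (head-latest (subst (AllPairs LaterThan) eq (childRx-latestFirst t v))
        (subst (λ l → (t₀ , μ₀) ∈ˡ l) eq (childRx-complete {t₀} {t} child₀ tx₀ t₀<t)))
      where
      upper : proj₁ e ≤ t₀
      upper =
        let u , u∈ , tx , _ = childRx-sound {proj₁ e} {t} {v} {proj₂ e}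
                                (subst (λ l → e ∈ˡ l) (sym eq) (here refl))
            _ , ((_ , _ , only , _) , _) , t′≤ = done≤ u∈
        in subst (_≤ t₀) (sym (only tx)) t′≤

    some-reception : ∀ {t} → t₀ < t → ∃₂ λ e es → childRx t v ≡ e ∷ es
    some-reception {t} t₀<t = nonempty (childRx-complete {t₀} {t} child₀ tx₀ t₀<t)

    -- Up to round t₀ some child is missing and v is silent.  Afterwards the count is
    -- complete and the latest reception stays the one of round t₀, so the phase of the
    -- transmission is the closest one after that of t₀, and no other.
    inner-transmits : ∃ (DoneBy (suc κ) v)
    inner-transmits
      with q , closest@((t₀/3<q , _) , _) , q< ←
             closestPhase-exists κ (toℕ<n (s v)) (proj₂ done₀)
      = t , (_ , sends , only , collected) ,
        subst (_< suc κ * Δ) (sym t/3) q<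
      where
      t = round q v
      t/3 = round/3 q v

      t₀<t : t₀ < t
      t₀<t = ≰⇒> λ t≤t₀ → <⇒≱ t₀/3<q (subst (_≤ t₀ / 3) t/3 (/-monoˡ-≤ 3 t≤t₀))

      sends : Tx t v (message (control v)
        (fromMaybe (own v) ++ concatMap (Message.content ∘ proj₂) (hist t v)))
      sends = let e , es , eq = some-reception {t} t₀<t in
        phase-tx (round%3 q v)
          (trans (inner-phase t v inner)
            (innerContent-complete (L v) (own v) (hist t v) (t / 3) eq (heard-all {t} t₀<t)
              (subst₂ (ClosestPhase Δ (toℕ (s v)))
                (cong (_/ 3) (sym (latest-reception {t} t₀<t eq))) (sym t/3) closest)))

      only : ∀ {t′ μ′} → Tx t′ v μ′ → t′ ≡ t
      only {t′} tx =
        let level≡ , _ , content≡ = tx-phase tx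
            _ , _ , receptions , heard≡ , closest′ = inner-phase-sound t′ v inner content≡
            t₀<t′ = ≰⇒> λ t′≤t₀ → heard-too-few {t′} t′≤t₀ heard≡
        in trans (round-unique level≡) (cong (λ q → round q v)
             (closestPhase-unique {Δ}
               (subst (λ x → ClosestPhase Δ (toℕ (s v)) (x / 3) (t′ / 3))
                 (latest-reception {t′} t₀<t′ receptions) closest′)
               closest))

      collected : ∀ i → Ancestor v (source i) →
        msg i ∈ˡ fromMaybe (own v) ++ concatMap (Message.content ∘ proj₂) (hist t v)
      collected = gathered λ u∈ →
        let t′ , (lone , _) , t′≤ = done≤ u∈ in t′ , lone , ≤-<-trans t′≤ t₀<t

  -- Induction from the deepest level upwards: a node v of T′, not the root, has
  -- transmitted within the first κ * Δ phases when κ exceeds D minus the level of v.  The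
  -- base case is empty, as no level exceeds the diameter.
  transmits : ∀ κ {v} → v ∈ T′ → v ≢ r → D < level v + κ → ∃ (DoneBy κ v)
  transmits zero {v} _ _ D<
    with d , d≤D , walk ← proj₁ diameter r v
    = contradiction (≤-trans (proj₂ (level-dist v) d walk) d≤D)
                    (<⇒≱ (subst (D <_) (+-identityʳ _) D<))
  transmits (suc κ) {v} v∈ v≢r D< with childCount T T′ v ≟ 0
  ... | yes leaf = leaf-transmits κ v∈ v≢r leaf
  ... | no inner = inner-transmits {κ} inner λ u∈ →
    let child , u∈T′ = kid-sound u∈ in
    transmits κ u∈T′ (proj₁ child)
      (subst (D <_) (trans (+-suc _ κ) (cong (_+ κ) (sym (level-child child)))) D<)

  -- The children of the root have level 1, so they are done within D * Δ phases of three
  -- rounds.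
  root-gathers : ∀ i → msg i ∈ˡ
    Execution.known G algorithmA label own (3 * (D * Δ)) r
  root-gathers i = gathered done i (root-ancestor (source i))
    where
    done : ∀ {u} → u ∈ˡ kids r → ∃[ t ] (OnlyTransmission u t × t < 3 * (D * Δ))
    done u∈ =
      let child , u∈T′ = kid-sound u∈
          t , lone , t/3< = transmits D u∈T′ (proj₁ child)
            (subst (λ ℓ → D < ℓ + D)
              (sym (trans (level-child child) (cong suc level-root))) (n<1+n D))
      in t , lone , (begin-strict
        t                   ≡⟨ m≡m%n+[m/n]*n t 3 ⟩
        t % 3 + t / 3 * 3   <⟨ +-monoˡ-< (t / 3 * 3) (m%n<n t 3) ⟩
        suc (t / 3) * 3     ≤⟨ *-monoˡ-≤ 3 t/3< ⟩
        D * Δ * 3           ≡⟨ *-comm (D * Δ) 3 ⟩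
        3 * (D * Δ)         ∎)
      where open ≤-Reasoning

-- The size of the labels

module _ {n Δ : ℕ} {G : Network n} {r : Fin n} (T : BFSTree G r) (T′ : Subset n)
         (maxDegree : IsMaxDegree G Δ)
         (s : Fin n → Fin Δ) (c : Fin n → Fin (suc (Δ ^ 2))) where
  open Network G
  open Tree T
  open Kids T T′

  childCount≤Δ : ∀ v → childCount T T′ v ≤ Δ
  childCount≤Δ v = ≤-trans
    (length-≤-matching {R = _≡_} {kids v} {neighbours G v} (kids-unique v)
      (λ u∈ → _ , neighbours-complete G (symmetric (child-adj (proj₁ (kid-sound u∈)))) , refl)
      (λ _ _ x≡ x′≡ → trans x≡ (sym x′≡)))
    (proj₁ maxDegree v)

  length-labels : ∀ v → length (labels T T′ s c v) ≤ 54 * (1 ⊔ ⌊log₂ Δ ⌋)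
  length-labels v = begin
    length (labels T T′ s c v)   ≤⟨ length-encode
      (labelData (toℕ (s v)) (toℕ (c v)) (toℕ (c (parent v))) Δ (childCount T T′ v)
                 (level v % 3)) (2 * suc ℓ)
      (small (<⇒≤ (toℕ<n (s v)))) (colour (c v)) (colour (c (parent v)))
      (small ≤-refl) (small (childCount≤Δ v)) level< ⟩
    6 * suc (2 * (2 * suc ℓ))    ≡⟨ expand ℓ ⟩
    24 * ℓ + 30 * 1              ≤⟨ +-monoʳ-≤ (24 * ℓ) (*-monoʳ-≤ 30 1≤ℓ) ⟩
    24 * ℓ + 30 * ℓ              ≡⟨ *-distribʳ-+ ℓ 24 30 ⟨
    54 * ℓ                       ∎
    where
    open ≤-Reasoning
    ℓ = 1 ⊔ ⌊log₂ Δ ⌋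

    1≤ℓ : 1 ≤ ℓ
    1≤ℓ = m≤m⊔n 1 ⌊log₂ Δ ⌋

    -- Both Δ and its square are below 2 ^ (2 * suc ℓ); each of the six numbers thus costs
    -- at most 4 * ℓ + 5 bits.
    expand : ∀ ℓ → 6 * suc (2 * (2 * suc ℓ)) ≡ 24 * ℓ + 30 * 1
    expand = solve-∀

    Δ<2^ : Δ < 2 ^ suc ℓ
    Δ<2^ = <-≤-trans (<2^[1+⌊log₂⌋] Δ) (^-monoʳ-≤ 2 (s≤s (m≤n⊔m 1 ⌊log₂ Δ ⌋)))

    2^≤ : 2 ^ suc ℓ ≤ 2 ^ (2 * suc ℓ)
    2^≤ = ^-monoʳ-≤ 2 (m≤n*m (suc ℓ) 2)

    small : ∀ {x} → x ≤ Δ → x < 2 ^ (2 * suc ℓ)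
    small x≤Δ = <-≤-trans (≤-<-trans x≤Δ Δ<2^) 2^≤

    Δ²<2^ : Δ ^ 2 < 2 ^ (2 * suc ℓ)
    Δ²<2^ = subst (Δ ^ 2 <_)
      (trans (^-*-assoc 2 (suc ℓ) 2) (cong (2 ^_) (*-comm (suc ℓ) 2)))
      (^-monoˡ-< 2 Δ<2^)

    colour : (x : Fin (suc (Δ ^ 2))) → toℕ x < 2 ^ (2 * suc ℓ)
    colour x = ≤-<-trans (s≤s⁻¹ (toℕ<n x)) Δ²<2^

    level< : level v % 3 < 2 ^ (2 * suc ℓ)
    level< = <-≤-trans (m%n<n (level v) 3)
      (≤-trans (n≤1+n 3) (≤-trans (^-monoʳ-≤ 2 (s≤s 1≤ℓ)) 2^≤))

lemma4 : ∃₂ λ (a b : ℕ) →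
    ∀ (n : ℕ) (G : Network n) (D Δ : ℕ) → IsDiameter G D → IsMaxDegree G Δ →
    (r : Fin n) (k : ℕ) (source : Fin k → Fin n) → Injective _≡_ _≡_ source →
    (T : BFSTree G r) (T′ : Subset n) → IsSmallestSubtree T source T′ →
    (s : Fin n → Fin Δ) → IsSlotAssignment T s →
    (c : Fin n → Fin (suc (Δ ^ 2))) → IsDistanceTwoColouring G c →
    Gathers G algorithmA (labels T T′ s c) source r (a * (D * Δ)) ×
    (∀ v → length (labels T T′ s c v) ≤ b * (1 ⊔ ⌊log₂ Δ ⌋))
lemma4 = 3 , 54 ,
  λ n G D Δ diameter maxDegree r k source injective T T′ smallest s slots c colouring →
    (λ M msg → Gathering.root-gathers diameter injective T smallest slots colouring
      (labels T T′ s c) (λ v → decode-encode _) msg) ,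
    length-labels T T′ maxDegree s c
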